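{- For $m=2$ machines, consider the two-solution ordinal algorithm with the following two solutions. First solution: machine $1$ gets all jobs $j\ge 1$ with $j\equiv 1 \pmod 4$, i.e. $\{1,5,9,13,\ldots\}$, and machine $2$ gets all other jobs, i.e. $\{2,3,4,6,7,8,\ldots\}$. Second solution: machine $1$ gets job $1$ and all even indexes excluding $2$, i.e. $\{1,4,6,8,10,\ldots\}$, and machine $2$ gets job $2$ and all odd indexes excluding $1$, i.e. $\{2,3,5,7,9,11,\ldots\}$. The competitive ratio of this algorithm is at most $1.25$.
   Context: Ordinal makespan scheduling on $m$ identical machines. Jobs are indexed by positive integers. A realization is a sequence of real job sizes $p_1\ge p_2\ge p_3\ge\cdots\ge 0$ with only finitely many positive sizes. A solution is a partition of the set of all positive integers into $m$ sets $J_1,\dots,J_m$, where $J_i$ is the set of jobs assigned to machine $i$; it is fixed without knowledge of the realization. For a realization, the load of machine $i$ in the solution is $\sum_{j\in J_i}p_j$, and the completion time of the solution is the maximum load of any machine. A two-solution ordinal algorithm consists of two solutions; its makespan for a realization is the minimum of the completion times of its two solutions for that realization. The optimal offline completion time $\lambda$ of a realization is the minimum completion time over all solutions (chosen with full knowledge of the realization). The competitive ratio of the algorithm is the supremum, over all realizations with $\lambda>0$, of the ratio between its makespan and $\lambda$. -}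

module Defs where

open import Data.Bool.Base using (if_then_else_; _∧_; _∨_; not)
open import Data.Fin.Base using (Fin; zero; suc)
open import Data.Fin.Patterns using (0F; 1F)
import Data.Fin.Properties as Fin
open import Data.Nat.Base as ℕ using (ℕ; zero; suc; _%_; _≡ᵇ_)
import Data.Nat.Properties as ℕ
open import Data.Product.Base using (∃; _×_; _,_)
open import Data.Rational.Base as ℚ using (ℚ; 0ℚ; 1ℚ; ½; Positive; ∣_∣)
import Data.Rational.Properties as ℚ
open import Data.Rational.Solver using (module +-*-Solver)
open import Data.Sum.Base using (inj₁; inj₂)
open import Function.Base using (_∘_)
open import Relation.Binary.PropositionalEquality
  using (_≡_; refl; sym; trans; cong; cong₂; subst; subst₂)
open import Relation.Nullary using (¬_; does)

open +-*-Solver using (solve; _:+_; _:*_; :-_; _:-_; _:=_; con)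

p≤∣p∣ : ∀ p → p ℚ.≤ ∣ p ∣
p≤∣p∣ p with ℚ.≤-total 0ℚ p
... | inj₁ 0≤p = ℚ.≤-reflexive (sym (ℚ.0≤p⇒∣p∣≡p 0≤p))
... | inj₂ p≤0 = ℚ.≤-trans p≤0 (ℚ.nonNegative⁻¹ ∣ p ∣ {{ℚ.∣-∣-nonNeg p}})

∣-∣-comm : ∀ p q → ∣ p ℚ.- q ∣ ≡ ∣ q ℚ.- p ∣
∣-∣-comm p q = trans (sym (ℚ.∣-p∣≡∣p∣ (p ℚ.- q)))
  (cong ∣_∣ (solve 2 (λ a b → :- (a :- b) := b :- a) refl p q))

∣-∣≤⇒≤+ : ∀ p q {ε} → ∣ p ℚ.- q ∣ ℚ.≤ ε → p ℚ.≤ q ℚ.+ ε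
∣-∣≤⇒≤+ p q h = subst (ℚ._≤ _)
  (solve 2 (λ a b → b :+ (a :- b) := a) refl p q)
  (ℚ.+-monoʳ-≤ q (ℚ.≤-trans (p≤∣p∣ (p ℚ.- q)) h))

≤+⇒-≤ : ∀ p q {ε} → p ℚ.≤ q ℚ.+ ε → p ℚ.- q ℚ.≤ ε
≤+⇒-≤ p q {ε} h = subst (p ℚ.- q ℚ.≤_)
  (solve 2 (λ b e → b :+ e :- b := e) refl q ε)
  (ℚ.+-monoˡ-≤ (ℚ.- q) h)

≤+⇒∣-∣≤ : ∀ p q {ε} → p ℚ.≤ q ℚ.+ ε → q ℚ.≤ p ℚ.+ ε → ∣ p ℚ.- q ∣ ℚ.≤ ε
≤+⇒∣-∣≤ p q {ε} p≤ q≤ with ℚ.∣p∣≡p∨∣p∣≡-p (p ℚ.- q)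
... | inj₁ e = subst (ℚ._≤ ε) (sym e) (≤+⇒-≤ p q p≤)
... | inj₂ e = subst (ℚ._≤ ε)
  (sym (trans e (solve 2 (λ a b → :- (a :- b) := b :- a) refl p q)))
  (≤+⇒-≤ q p q≤)

⊔-≤+ : ∀ a b c d {ε} → a ℚ.≤ c ℚ.+ ε → b ℚ.≤ d ℚ.+ ε →
       a ℚ.⊔ b ℚ.≤ (c ℚ.⊔ d) ℚ.+ ε
⊔-≤+ a b c d {ε} a≤ b≤ = ℚ.⊔-lub
  (ℚ.≤-trans a≤ (ℚ.+-monoˡ-≤ ε (ℚ.p≤p⊔q c d)))
  (ℚ.≤-trans b≤ (ℚ.+-monoˡ-≤ ε (ℚ.p≤q⊔p c d)))

⊓-≤+ : ∀ a b c d {ε} → a ℚ.≤ c ℚ.+ ε → b ℚ.≤ d ℚ.+ ε →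
       a ℚ.⊓ b ℚ.≤ (c ℚ.⊓ d) ℚ.+ ε
⊓-≤+ a b c d {ε} a≤ b≤ with ℚ.⊓-sel c d
... | inj₁ e = subst (λ z → a ℚ.⊓ b ℚ.≤ z ℚ.+ ε) (sym e) (ℚ.≤-trans (ℚ.p⊓q≤p a b) a≤)
... | inj₂ e = subst (λ z → a ℚ.⊓ b ℚ.≤ z ℚ.+ ε) (sym e) (ℚ.≤-trans (ℚ.p⊓q≤q a b) b≤)

⊔-close : ∀ a b c d {ε} → ∣ a ℚ.- c ∣ ℚ.≤ ε → ∣ b ℚ.- d ∣ ℚ.≤ ε →
          ∣ (a ℚ.⊔ b) ℚ.- (c ℚ.⊔ d) ∣ ℚ.≤ ε
⊔-close a b c d h k = ≤+⇒∣-∣≤ (a ℚ.⊔ b) (c ℚ.⊔ d)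
  (⊔-≤+ a b c d (∣-∣≤⇒≤+ a c h) (∣-∣≤⇒≤+ b d k))
  (⊔-≤+ c d a b (∣-∣≤⇒≤+ c a (subst (ℚ._≤ _) (∣-∣-comm a c) h))
                (∣-∣≤⇒≤+ d b (subst (ℚ._≤ _) (∣-∣-comm b d) k)))

⊓-close : ∀ a b c d {ε} → ∣ a ℚ.- c ∣ ℚ.≤ ε → ∣ b ℚ.- d ∣ ℚ.≤ ε →
          ∣ (a ℚ.⊓ b) ℚ.- (c ℚ.⊓ d) ∣ ℚ.≤ ε
⊓-close a b c d h k = ≤+⇒∣-∣≤ (a ℚ.⊓ b) (c ℚ.⊓ d)
  (⊓-≤+ a b c d (∣-∣≤⇒≤+ a c h) (∣-∣≤⇒≤+ b d k))
  (⊓-≤+ c d a b (∣-∣≤⇒≤+ c a (subst (ℚ._≤ _) (∣-∣-comm a c) h))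
                (∣-∣≤⇒≤+ d b (subst (ℚ._≤ _) (∣-∣-comm b d) k)))

+-close : ∀ a b c d {δ ε} → ∣ a ℚ.- c ∣ ℚ.≤ δ → ∣ b ℚ.- d ∣ ℚ.≤ ε →
          ∣ (a ℚ.+ b) ℚ.- (c ℚ.+ d) ∣ ℚ.≤ δ ℚ.+ ε
+-close a b c d h k = ℚ.≤-trans
  (subst (ℚ._≤ ∣ a ℚ.- c ∣ ℚ.+ ∣ b ℚ.- d ∣)
    (cong ∣_∣ (solve 4 (λ a b c d → (a :- c) :+ (b :- d) := (a :+ b) :- (c :+ d))
               refl a b c d))
    (ℚ.∣p+q∣≤∣p∣+∣q∣ (a ℚ.- c) (b ℚ.- d)))
  (ℚ.+-mono-≤ h k)

*-mono-∣∣ : ∀ p q {r s} → ∣ p ∣ ℚ.≤ r → ∣ q ∣ ℚ.≤ s → ∣ p ℚ.* q ∣ ℚ.≤ r ℚ.* s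
*-mono-∣∣ p q {r} {s} h k = subst (ℚ._≤ r ℚ.* s) (sym (ℚ.∣p*q∣≡∣p∣*∣q∣ p q))
  (ℚ.≤-trans
    (ℚ.*-monoʳ-≤-nonNeg ∣ q ∣ {{ℚ.∣-∣-nonNeg q}} h)
    (ℚ.*-monoˡ-≤-nonNeg r {{ℚ.nonNegative (ℚ.≤-trans 0≤∣p∣ h)}} k))
  where 0≤∣p∣ = ℚ.nonNegative⁻¹ ∣ p ∣ {{ℚ.∣-∣-nonNeg p}}

*-close : ∀ a b c d {B ε} → ∣ a ∣ ℚ.≤ B → ∣ d ∣ ℚ.≤ B →
          ∣ a ℚ.- c ∣ ℚ.≤ ε → ∣ b ℚ.- d ∣ ℚ.≤ ε →
          ∣ (a ℚ.* b) ℚ.- (c ℚ.* d) ∣ ℚ.≤ (B ℚ.+ B) ℚ.* ε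
*-close a b c d {B} {ε} a≤ d≤ h k = subst₂ ℚ._≤_
  (cong ∣_∣ (solve 4 (λ a b c d →
     a :* (b :- d) :+ d :* (a :- c) := (a :* b) :- (c :* d)) refl a b c d))
  (sym (ℚ.*-distribʳ-+ ε B B))
  (ℚ.≤-trans (ℚ.∣p+q∣≤∣p∣+∣q∣ (a ℚ.* (b ℚ.- d)) (d ℚ.* (a ℚ.- c)))
    (ℚ.+-mono-≤ (*-mono-∣∣ a (b ℚ.- d) a≤ k) (*-mono-∣∣ d (a ℚ.- c) d≤ h)))

half : ∀ ε → ½ ℚ.* ε ℚ.+ ½ ℚ.* ε ≡ ε
half = solve 1 (λ e → con ½ :* e :+ con ½ :* e := e) refl

half-pos : ∀ ε → .{{Positive ε}} → Positive (½ ℚ.* ε)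
half-pos ε = ℚ.pos*pos⇒pos ½ ε

shrink : ∀ B ε → .(Positive B) → .(Positive ε) → ∃ λ ε′ → Positive ε′ × B ℚ.* ε′ ≡ ε
shrink B ε B>0 ε>0 = ℚ.1/ B ℚ.* ε
  , ℚ.pos*pos⇒pos (ℚ.1/ B) {{ℚ.1/pos⇒pos B {{B>0}}}} ε {{ε>0}}
  , trans (sym (ℚ.*-assoc B (ℚ.1/ B) ε))
      (trans (cong (ℚ._* ε) (ℚ.*-inverseʳ B)) (ℚ.*-identityˡ ε))
  where
  instance
    B≢0 : ℚ.NonZero B
    B≢0 = ℚ.pos⇒nonZero B {{B>0}}

-- The reciprocal p ↦ 1/p on [δ , ∞), extended to ℚ as a constant.
module _ (δ : ℚ) .{{δ>0 : Positive δ}} where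

  ⊔-pos : ∀ p → Positive (δ ℚ.⊔ p)
  ⊔-pos p = ℚ.positive (ℚ.<-≤-trans (ℚ.positive⁻¹ δ) (ℚ.p≤p⊔q δ p))

  recip : ℚ → ℚ
  recip p = (ℚ.1/ (δ ℚ.⊔ p)) {{ℚ.pos⇒nonZero (δ ℚ.⊔ p) {{⊔-pos p}}}}

  recip-inverse : ∀ p → (δ ℚ.⊔ p) ℚ.* recip p ≡ 1ℚ
  recip-inverse p = ℚ.*-inverseʳ (δ ℚ.⊔ p) {{ℚ.pos⇒nonZero (δ ℚ.⊔ p) {{⊔-pos p}}}}

  recip-close : ∀ p q {ε} → ∣ p ℚ.- q ∣ ℚ.≤ (δ ℚ.* δ) ℚ.* ε → ∣ recip p ℚ.- recip q ∣ ℚ.≤ ε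
  recip-close p q {ε} h = ℚ.*-cancelˡ-≤-pos (δ ℚ.* δ) {{ℚ.pos*pos⇒pos δ δ}}
    (ℚ.≤-trans
      (ℚ.*-monoʳ-≤-nonNeg ∣ r ℚ.- s ∣ {{ℚ.∣-∣-nonNeg (r ℚ.- s)}} δδ≤ab)
      (subst (ℚ._≤ (δ ℚ.* δ) ℚ.* ε) (sym ab∣r-s∣) close))
    where
    a = δ ℚ.⊔ p
    b = δ ℚ.⊔ q
    r = recip p
    s = recip q
    instance
      a>0 = ⊔-pos p
      b>0 = ⊔-pos q
      ab>0 = ℚ.pos*pos⇒pos a b
    δδ≤ab : δ ℚ.* δ ℚ.≤ a ℚ.* b
    δδ≤ab = ℚ.≤-trans
      (ℚ.*-monoʳ-≤-nonNeg δ {{ℚ.pos⇒nonNeg δ}} (ℚ.p≤p⊔q δ p))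
      (ℚ.*-monoˡ-≤-nonNeg a {{ℚ.pos⇒nonNeg a}} (ℚ.p≤p⊔q δ q))
    ab[r-s] : (a ℚ.* b) ℚ.* (r ℚ.- s) ≡ b ℚ.- a
    ab[r-s] = trans
      (solve 4 (λ a b r s → (a :* b) :* (r :- s) := b :* (a :* r) :- a :* (b :* s))
         refl a b r s)
      (trans
        (cong₂ (λ u v → b ℚ.* u ℚ.- a ℚ.* v) (recip-inverse p) (recip-inverse q))
        (cong₂ ℚ._-_ (ℚ.*-identityʳ b) (ℚ.*-identityʳ a)))
    ab∣r-s∣ : (a ℚ.* b) ℚ.* ∣ r ℚ.- s ∣ ≡ ∣ a ℚ.- b ∣
    ab∣r-s∣ = trans
      (cong (ℚ._* ∣ r ℚ.- s ∣)
        (sym (ℚ.0≤p⇒∣p∣≡p (ℚ.<⇒≤ (ℚ.positive⁻¹ (a ℚ.* b))))))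
      (trans (sym (ℚ.∣p*q∣≡∣p∣*∣q∣ (a ℚ.* b) (r ℚ.- s)))
        (trans (cong ∣_∣ ab[r-s]) (∣-∣-comm b a)))
    close : ∣ a ℚ.- b ∣ ℚ.≤ (δ ℚ.* δ) ℚ.* ε
    close = ⊔-close δ p δ q
      (ℚ.≤-trans
        (subst (ℚ._≤ ∣ p ℚ.- q ∣) (cong ∣_∣ (sym (ℚ.+-inverseʳ δ)))
          (ℚ.nonNegative⁻¹ ∣ p ℚ.- q ∣ {{ℚ.∣-∣-nonNeg (p ℚ.- q)}}))
        h)
      h

------------------------------------------------------------------------
-- Real numbers, after Cantor: Cauchy sequences of rationals, considered
-- up to the equality _≈_.

Eventually : (ℕ → Set) → Set
Eventually P = ∃ λ N → ∀ n → N ℕ.≤ n → P n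

Eventually₂ : (ℕ → ℕ → Set) → Set
Eventually₂ P = ∃ λ N → ∀ m n → N ℕ.≤ m → N ℕ.≤ n → P m n

IsCauchy : (ℕ → ℚ) → Set
IsCauchy x = ∀ ε → .{{Positive ε}} → Eventually₂ λ m n → ∣ x m ℚ.- x n ∣ ℚ.≤ ε

record ℝ : Set where
  constructor mkℝ
  field
    seq    : ℕ → ℚ
    cauchy : IsCauchy seq

open ℝ public

infix  4 _≈_ _≤_ _<_
infixl 6 _+_ _⊔_
infixl 7 _*_ _⊓_

_≈_ _≤_ _<_ : ℝ → ℝ → Set
x ≈ y = ∀ ε → .{{Positive ε}} → Eventually λ n → ∣ seq x n ℚ.- seq y n ∣ ℚ.≤ ε
x ≤ y = ∀ ε → .{{Positive ε}} → Eventually λ n → seq x n ℚ.≤ seq y n ℚ.+ ε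
x < y = ∃ λ δ → Positive δ × Eventually λ n → seq x n ℚ.+ δ ℚ.≤ seq y n

fromℚ : ℚ → ℝ
fromℚ q = mkℝ (λ _ → q) λ ε {{ε>0}} → 0 , λ _ _ _ _ →
  subst (ℚ._≤ ε) (cong ∣_∣ (sym (ℚ.+-inverseʳ q))) (ℚ.<⇒≤ (ℚ.positive⁻¹ ε))

0ℝ : ℝ
0ℝ = fromℚ 0ℚ

zipEventually₂ : ∀ {P Q R : ℕ → ℕ → Set} → (∀ {m n} → P m n → Q m n → R m n) →
                 Eventually₂ P → Eventually₂ Q → Eventually₂ R
zipEventually₂ f (M , p) (N , q) = M ℕ.⊔ N , λ m n m≥ n≥ → f
  (p m n (ℕ.m⊔n≤o⇒m≤o M N m≥) (ℕ.m⊔n≤o⇒m≤o M N n≥))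
  (q m n (ℕ.m⊔n≤o⇒n≤o M N m≥) (ℕ.m⊔n≤o⇒n≤o M N n≥))

bounded : ∀ x → ∃ λ B → Positive B × Eventually₂ λ m n → ∣ seq x m ∣ ℚ.≤ B × ∣ seq x n ∣ ℚ.≤ B
bounded x with cauchy x 1ℚ
... | N , c = ∣ seq x N ∣ ℚ.+ 1ℚ
    , ℚ.positive (ℚ.+-mono-≤-< (ℚ.nonNegative⁻¹ ∣ seq x N ∣ {{ℚ.∣-∣-nonNeg (seq x N)}})
                                (ℚ.positive⁻¹ 1ℚ))
    , N , λ m n m≥ n≥ → bound m m≥ , bound n n≥
  where
  bound : ∀ n → N ℕ.≤ n → ∣ seq x n ∣ ℚ.≤ ∣ seq x N ∣ ℚ.+ 1ℚ
  bound n n≥ = ℚ.≤-trans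
    (subst (ℚ._≤ ∣ seq x N ∣ ℚ.+ ∣ seq x n ℚ.- seq x N ∣)
      (cong ∣_∣ (solve 2 (λ a b → b :+ (a :- b) := a) refl (seq x n) (seq x N)))
      (ℚ.∣p+q∣≤∣p∣+∣q∣ (seq x N) (seq x n ℚ.- seq x N)))
    (ℚ.+-monoʳ-≤ ∣ seq x N ∣ (c n N n≥ ℕ.≤-refl))

*-cauchy : ∀ x y → IsCauchy λ n → seq x n ℚ.* seq y n
*-cauchy x y ε {{ε>0}} =
  let B , B>0 , x≤B = bounded x
      C , C>0 , y≤C = bounded y
      D   = B ℚ.⊔ C
      D>0 = ⊔-pos B {{B>0}} C
      ε′ , ε′>0 , eq = shrink (D ℚ.+ D) ε (ℚ.pos+pos⇒pos D {{D>0}} D {{D>0}}) ε>0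
  in zipEventually₂
    (λ {m} {n} (a≤ , d≤) (h , k) →
      subst (∣ seq x m ℚ.* seq y m ℚ.- seq x n ℚ.* seq y n ∣ ℚ.≤_) eq
        (*-close (seq x m) (seq y m) (seq x n) (seq y n)
          (ℚ.≤-trans a≤ (ℚ.p≤p⊔q B C)) (ℚ.≤-trans d≤ (ℚ.p≤q⊔p B C)) h k))
    (zipEventually₂ (λ (a≤ , _) (_ , d≤) → a≤ , d≤) x≤B y≤C)
    (zipEventually₂ _,_ (cauchy x ε′ {{ε′>0}}) (cauchy y ε′ {{ε′>0}}))

_+_ _⊔_ _⊓_ _*_ : ℝ → ℝ → ℝ

x + y = mkℝ (λ n → seq x n ℚ.+ seq y n) λ ε {{ε>0}} → zipEventually₂
  (λ {m} {n} h k → subst (_ ℚ.≤_) (half ε)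
    (+-close (seq x m) (seq y m) (seq x n) (seq y n) h k))
  (cauchy x (½ ℚ.* ε) {{half-pos ε}})
  (cauchy y (½ ℚ.* ε) {{half-pos ε}})

x ⊔ y = mkℝ (λ n → seq x n ℚ.⊔ seq y n) λ ε → zipEventually₂
  (λ {m} {n} → ⊔-close (seq x m) (seq y m) (seq x n) (seq y n))
  (cauchy x ε) (cauchy y ε)

x ⊓ y = mkℝ (λ n → seq x n ℚ.⊓ seq y n) λ ε → zipEventually₂
  (λ {m} {n} → ⊓-close (seq x m) (seq y m) (seq x n) (seq y n))
  (cauchy x ε) (cauchy y ε)

x * y = mkℝ (λ n → seq x n ℚ.* seq y n) (*-cauchy x y)

-- A proof of 0 < x provides δ > 0 with δ ≤ xₙ for all large n, so that the
-- n-th term 1 / (δ ⊔ xₙ) is eventually 1 / xₙ.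
inverse : (x : ℝ) → 0ℝ < x → ℝ
inverse x (δ , δ>0 , _) = mkℝ (λ n → recip δ {{δ>0}} (seq x n)) λ ε {{ε>0}} →
  let N , c = cauchy x ((δ ℚ.* δ) ℚ.* ε)
                {{ℚ.pos*pos⇒pos (δ ℚ.* δ) {{ℚ.pos*pos⇒pos δ {{δ>0}} δ {{δ>0}}}} ε}}
  in N , λ m n m≥ n≥ → recip-close δ {{δ>0}} (seq x m) (seq x n) (c m n m≥ n≥)

divide : ℝ → (y : ℝ) → 0ℝ < y → ℝ
divide x y y>0 = x * inverse y y>0

sum : ℕ → (ℕ → ℝ) → ℝ
sum zero    f = 0ℝ
sum (suc n) f = sum n f + f n

maximum : ∀ {m} → (Fin (suc m) → ℝ) → ℝ
maximum {zero}  f = f zero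
maximum {suc m} f = f zero ⊔ maximum (f ∘ suc)

------------------------------------------------------------------------
-- Scheduling.  The natural number k stands for the job of index k + 1.

record Realization : Set where
  field
    size          : ℕ → ℝ
    nonincreasing : ∀ k → size (suc k) ≤ size k
    nonnegative   : ∀ k → 0ℝ ≤ size k
    support       : ℕ
    vanishing     : ∀ k → support ℕ.≤ k → size k ≈ 0ℝ

open Realization public

-- A partition into m sets is given by the map taking each job to its machine.
Solution : ℕ → Set
Solution m = ℕ → Fin m

byIndex : ∀ {m} → (ℕ → Fin m) → Solution m
byIndex f k = f (suc k)

-- The jobs outside the support contribute nothing to the infinite sum.
load : ∀ {m} → Solution m → Realization → Fin m → ℝ
load S p i = sum (support p) λ k → if does (S k Fin.≟ i) then size p k else 0ℝ

completionTime : ∀ {m} → Solution (suc m) → Realization → ℝ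
completionTime S p = maximum (load S p)

-- The minimum of the completion times.  Since ≤ is undecidable on ℝ, it cannot
-- be decided which solution attains it; hence the double negation.
IsOptimal : ∀ m → Realization → ℝ → Set
IsOptimal m p opt =
  (∀ (S : Solution (suc m)) → opt ≤ completionTime S p) ×
  ¬ ¬ (∃ λ (S : Solution (suc m)) → completionTime S p ≈ opt)

record TwoSolutionAlgorithm (m : ℕ) : Set where
  field
    first second : Solution m

open TwoSolutionAlgorithm public

makespan : ∀ {m} → TwoSolutionAlgorithm (suc m) → Realization → ℝ
makespan A p = completionTime (first A) p ⊓ completionTime (second A) p

-- The supremum (a priori possibly infinite) of the ratios is at most c exactly
-- when c is an upper bound of the ratios.
CompetitiveRatioAtMost : ∀ {m} → TwoSolutionAlgorithm (suc m) → ℝ → Set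
CompetitiveRatioAtMost {m} A c =
  ∀ (p : Realization) (opt : ℝ) → IsOptimal m p opt →
  (opt>0 : 0ℝ < opt) → divide (makespan A p) opt opt>0 ≤ c

-- 0F and 1F are machines 1 and 2.
algorithm : TwoSolutionAlgorithm 2
algorithm .first  = byIndex λ j → if j % 4 ≡ᵇ 1 then 0F else 1F
algorithm .second = byIndex λ j →
  if (j ≡ᵇ 1) ∨ ((j % 2 ≡ᵇ 0) ∧ not (j ≡ᵇ 2)) then 0F else 1F

{-# OPTIONS --safe #-}

-- Both solutions of the algorithm, and an optimal one, are compared through
-- weighted sums of the nonincreasing job sizes: by Abel summation a weighted sum
-- is dominated by another as soon as its prefix weights are.  Write P for the
-- total size, Aᵢ and Bᵢ for the loads of the first and second solution, λ for the
-- optimum.  Prefix comparison gives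
--
--   4 A₁ ≤ 3 p₁ + P,    2 B₂ ≤ P + p₃,    2 A₂ + 3 B₁ ≤ 3 P.
--
-- Since P ≤ 2 λ, p₁ ≤ λ and 2 p₃ ≤ λ (two of the first three jobs share a
-- machine), A₁ and B₂ are at most 5/4 λ, and so is the smaller of A₂ and B₁, as
-- their convex combination 2/5 A₂ + 3/5 B₁ is at most 6/5 λ.

module Submission where

open import Defs
open import Data.Integer.Base using (+_)
open import Data.Rational.Base using (_/_)

open import Data.Bool.Base using (Bool; true; false; if_then_else_)
open import Data.Fin.Base using (Fin)
open import Data.Fin.Patterns using (0F; 1F)
import Data.Fin.Properties as Fin
open import Data.Nat.Base as ℕ using (ℕ; zero; suc; _%_)
import Data.Nat.Properties as ℕ
open import Data.Product.Base using (∃; _,_; proj₁; proj₂)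
open import Data.Rational.Base as ℚ using (ℚ; 0ℚ; 1ℚ; ½; Positive; NonNegative)
import Data.Rational.Properties as ℚ
open import Data.Rational.Solver using (module +-*-Solver)
open import Data.Sum.Base using (inj₁; inj₂)
open import Relation.Binary.Bundles using (Preorder; Setoid)
open import Relation.Binary.PropositionalEquality
  using (_≡_; _≗_; refl; sym; trans; cong; cong₂; subst; subst₂; _→-setoid_)
open import Relation.Nullary using (¬_; does; Stable)
open import Relation.Nullary.Decidable using (decidable-stable; dec-true; from-yes)

open +-*-Solver using (solve; _:+_; _:*_; _:=_; con)

-- The order of the reals, up to arbitrarily small errors

infix 4 _≲_ _≼_

-- The order of ℝ on underlying sequences; a record, so that x and y can be inferred.
record _≲_ (x y : ℕ → ℚ) : Set where
  constructor mk≲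
  field
    bound : ∀ ε → .{{Positive ε}} → Eventually λ n → x n ℚ.≤ y n ℚ.+ ε

open _≲_

mapEventually : ∀ {P Q : ℕ → Set} → (∀ {n} → P n → Q n) → Eventually P → Eventually Q
mapEventually f (M , p) = M , λ n n≥ → f (p n n≥)

zipEventually : ∀ {P Q R : ℕ → Set} → (∀ {n} → P n → Q n → R n) →
                Eventually P → Eventually Q → Eventually R
zipEventually f (M , p) (N , q) = M ℕ.⊔ N , λ n n≥ → f
  (p n (ℕ.m⊔n≤o⇒m≤o M N n≥)) (q n (ℕ.m⊔n≤o⇒n≤o M N n≥))

p≤p+ε : ∀ p ε → .{{Positive ε}} → p ℚ.≤ p ℚ.+ ε
p≤p+ε p ε = subst (ℚ._≤ p ℚ.+ ε) (ℚ.+-identityʳ p) (ℚ.+-monoʳ-≤ p (ℚ.<⇒≤ (ℚ.positive⁻¹ ε)))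

≤⇒≲ : ∀ {x y} → (∀ n → x n ℚ.≤ y n) → x ≲ y
≤⇒≲ {x} {y} h .bound ε = 0 , λ n _ → ℚ.≤-trans (h n) (p≤p+ε (y n) ε)

≲-reflexive : ∀ {x y} → x ≗ y → x ≲ y
≲-reflexive e = ≤⇒≲ λ n → ℚ.≤-reflexive (e n)

≲-trans : ∀ {x y z} → x ≲ y → y ≲ z → x ≲ z
≲-trans {x} {y} {z} h k .bound ε = zipEventually
  (λ {n} a b → ℚ.≤-trans a (ℚ.≤-trans (ℚ.+-monoˡ-≤ (½ ℚ.* ε) b) (ℚ.≤-reflexive
    (trans (ℚ.+-assoc (z n) _ _) (cong (z n ℚ.+_) (half ε))))))
  (bound h (½ ℚ.* ε) {{half-pos ε}}) (bound k (½ ℚ.* ε) {{half-pos ε}})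

≲-preorder : Preorder _ _ _
≲-preorder = record
  { _≲_ = _≲_
  ; isPreorder = record
    { isEquivalence = Setoid.isEquivalence (ℕ →-setoid ℚ)
    ; reflexive = ≲-reflexive
    ; trans = ≲-trans
    }
  }

open import Relation.Binary.Reasoning.Preorder ≲-preorder

≲-refl : ∀ {x} → x ≲ x
≲-refl = ≲-reflexive λ _ → refl

+-mono-≲ : ∀ {w x y z} → w ≲ x → y ≲ z → (λ n → w n ℚ.+ y n) ≲ (λ n → x n ℚ.+ z n)
+-mono-≲ {w} {x} {y} {z} h k .bound ε = zipEventually
  (λ {n} a b → ℚ.≤-trans (ℚ.+-mono-≤ a b) (ℚ.≤-reflexive
    (trans
      (solve 3 (λ x z e → (x :+ e) :+ (z :+ e) := (x :+ z) :+ (e :+ e)) refl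
         (x n) (z n) (½ ℚ.* ε))
      (cong (x n ℚ.+ z n ℚ.+_) (half ε)))))
  (bound h (½ ℚ.* ε) {{half-pos ε}}) (bound k (½ ℚ.* ε) {{half-pos ε}})

+-monoˡ-≲ : ∀ {w x} y → w ≲ x → (λ n → w n ℚ.+ y n) ≲ (λ n → x n ℚ.+ y n)
+-monoˡ-≲ y h = +-mono-≲ h (≲-refl {y})

+-monoʳ-≲ : ∀ w {x y} → x ≲ y → (λ n → w n ℚ.+ x n) ≲ (λ n → w n ℚ.+ y n)
+-monoʳ-≲ w h = +-mono-≲ (≲-refl {w}) h

*-monoˡ-≲ : ∀ a → .{{NonNegative a}} → ∀ {x y} → x ≲ y → (λ n → a ℚ.* x n) ≲ (λ n → a ℚ.* y n)
*-monoˡ-≲ a {x} {y} h .bound ε {{ε>0}} =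
  -- Dividing `ε` by `1ℚ ℚ.+ a` instead of `a` also covers `a` equal to zero.
  let ε′ , ε′>0 , eq = shrink (1ℚ ℚ.+ a) ε (ℚ.pos+nonNeg⇒pos 1ℚ a) ε>0
      instance _ = ε′>0
      aε′≤ε = subst₂ ℚ._≤_ (ℚ.+-identityˡ (a ℚ.* ε′))
        (trans (solve 2 (λ a e → e :+ a :* e := (con 1ℚ :+ a) :* e) refl a ε′) eq)
        (ℚ.+-monoˡ-≤ (a ℚ.* ε′) (ℚ.<⇒≤ (ℚ.positive⁻¹ ε′)))
  in mapEventually
    (λ {n} x≤ → ℚ.≤-trans (ℚ.*-monoˡ-≤-nonNeg a x≤)
      (ℚ.≤-trans (ℚ.≤-reflexive (ℚ.*-distribˡ-+ a (y n) ε′))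
        (ℚ.+-monoʳ-≤ (a ℚ.* y n) aε′≤ε)))
    (bound h ε′)

-- Single terms of `x` may be negative, so no termwise comparison is possible; the nonnegative
-- factor `b ℚ.- a` is split off instead.
*-monoʳ-≲ : ∀ {a b x} → a ℚ.≤ b → (λ _ → 0ℚ) ≲ x → (λ n → a ℚ.* x n) ≲ (λ n → b ℚ.* x n)
*-monoʳ-≲ {a} {b} {x} a≤b 0≲x = begin
  (λ n → a ℚ.* x n)
    ≈⟨ (λ n → solve 3 (λ a b x → a :* x := (b :- a) :* con 0ℚ :+ a :* x) refl a b (x n)) ⟩
  (λ n → (b ℚ.- a) ℚ.* 0ℚ ℚ.+ a ℚ.* x n)
    ≲⟨ +-monoˡ-≲ (λ n → a ℚ.* x n) (*-monoˡ-≲ (b ℚ.- a) {{ℚ.nonNegative 0≤b-a}} 0≲x) ⟩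
  (λ n → (b ℚ.- a) ℚ.* x n ℚ.+ a ℚ.* x n)
    ≈⟨ (λ n → solve 3 (λ a b x → (b :- a) :* x :+ a :* x := b :* x) refl a b (x n)) ⟩
  (λ n → b ℚ.* x n) ∎
  where
  open +-*-Solver using (_:-_)
  0≤b-a : 0ℚ ℚ.≤ b ℚ.- a
  0≤b-a = subst (ℚ._≤ b ℚ.- a) (ℚ.+-inverseʳ a) (ℚ.+-monoˡ-≤ (ℚ.- a) a≤b)

-- The threshold comes from the Cauchy moduli alone, so for each `n` only a decidable inequality of
-- rationals is left, and the double negation may be dropped. The index `K` is met only inside the
-- refutation; going from `n` to a far `m` and back costs `ε′` three times.
≤-stable : ∀ x y → Stable (x ≤ y)
≤-stable x y ¬¬x≤y ε {{ε>0}} =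
  let ε′ , ε′>0 , eq = shrink (+ 3 / 1) ε _ ε>0
      instance _ = ε′>0
      M , cx = cauchy x ε′
      N , cy = cauchy y ε′
  in M ℕ.⊔ N , λ n n≥ → decidable-stable (seq x n ℚ.≤? seq y n ℚ.+ ε) λ ¬h → ¬¬x≤y λ x≤y →
    let K , h = x≤y ε′
        m     = n ℕ.⊔ K
        n≥M   = ℕ.m⊔n≤o⇒m≤o M N n≥
        n≥N   = ℕ.m⊔n≤o⇒n≤o M N n≥
    in ¬h (ℚ.≤-trans (∣-∣≤⇒≤+ (seq x n) (seq x m) (cx n m n≥M (ℕ.m≤n⇒m≤n⊔o K n≥M)))
      (ℚ.≤-trans (ℚ.+-monoˡ-≤ ε′ (ℚ.≤-trans (h m (ℕ.m≤n⊔m n K))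
        (ℚ.+-monoˡ-≤ ε′ (∣-∣≤⇒≤+ (seq y m) (seq y n) (cy m n (ℕ.m≤n⇒m≤n⊔o K n≥N) n≥N)))))
        (ℚ.≤-reflexive (trans
          (solve 2 (λ y e → y :+ e :+ e :+ e := y :+ con (+ 3 / 1) :* e) refl (seq y n) ε′)
          (cong (seq y n ℚ.+_) eq)))))

-- Once the divisor is at least `δ`, `recip δ` is its true reciprocal and at most 1/δ, so an error
-- `ε ℚ.* δ` in the numerator costs at most `ε` in the quotient.
divide-≤ : ∀ x y (y>0 : 0ℝ < y) c → seq x ≲ (λ n → c ℚ.* seq y n) → divide x y y>0 ≤ fromℚ c
divide-≤ x y (δ , δ>0 , δ≤y) c h ε {{ε>0}} = zipEventually quotient≤ δ≤y
  (bound h (ε ℚ.* δ) {{ℚ.pos*pos⇒pos ε δ}})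
  where
  instance _ = δ>0
  quotient≤ : ∀ {n} → 0ℚ ℚ.+ δ ℚ.≤ seq y n → seq x n ℚ.≤ c ℚ.* seq y n ℚ.+ ε ℚ.* δ →
          seq x n ℚ.* recip δ (seq y n) ℚ.≤ c ℚ.+ ε
  quotient≤ {n} δ≤b a≤ = ℚ.≤-trans (ℚ.*-monoʳ-≤-nonNeg r a≤) (ℚ.≤-trans
    (ℚ.≤-reflexive (trans
      (solve 5 (λ b c d e r → (c :* b :+ e :* d) :* r := c :* (b :* r) :+ e :* (d :* r)) refl
         b c δ ε r)
      (trans (cong (λ t → c ℚ.* t ℚ.+ ε ℚ.* (δ ℚ.* r)) br≡1) (cong (ℚ._+ ε ℚ.* (δ ℚ.* r)) (ℚ.*-identityʳ c)))))
    (ℚ.+-monoʳ-≤ c (subst (ε ℚ.* (δ ℚ.* r) ℚ.≤_) (ℚ.*-identityʳ ε)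
      (ℚ.*-monoˡ-≤-nonNeg ε {{ℚ.pos⇒nonNeg ε}} δr≤1))))
    where
    b = seq y n
    r = recip δ b
    δ≤b′ : δ ℚ.≤ b
    δ≤b′ = subst (ℚ._≤ b) (ℚ.+-identityˡ δ) δ≤b
    br≡1 : b ℚ.* r ≡ 1ℚ
    br≡1 = subst (λ t → t ℚ.* r ≡ 1ℚ) (ℚ.p≤q⇒p⊔q≡q δ≤b′) (recip-inverse δ b)
    instance
      r≥0 : NonNegative r
      r≥0 = ℚ.pos⇒nonNeg r {{ℚ.1/pos⇒pos (δ ℚ.⊔ b) {{⊔-pos δ b}}}}
    δr≤1 : δ ℚ.* r ℚ.≤ 1ℚ
    δr≤1 = subst (δ ℚ.* r ℚ.≤_) br≡1 (ℚ.*-monoʳ-≤-nonNeg r δ≤b′)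

-- Weighted sums of job sizes and Abel summation

weigh : (ℕ → ℚ) → (ℕ → ℕ → ℚ) → ℕ → ℕ → ℚ
weigh w p zero    n = 0ℚ
weigh w p (suc K) n = weigh w p K n ℚ.+ w K ℚ.* p K n

weigh-cong : ∀ {u v} → u ≗ v → ∀ p K n → weigh u p K n ≡ weigh v p K n
weigh-cong e p zero    n = refl
weigh-cong e p (suc K) n = cong₂ ℚ._+_ (weigh-cong e p K n) (cong (ℚ._* p K n) (e K))

weigh-linear : ∀ a b u v p K n → weigh (λ k → a ℚ.* u k ℚ.+ b ℚ.* v k) p K n ≡
               a ℚ.* weigh u p K n ℚ.+ b ℚ.* weigh v p K n
weigh-linear a b u v p zero    n = solve 2 (λ a b → con 0ℚ := a :* con 0ℚ :+ b :* con 0ℚ) refl a b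
weigh-linear a b u v p (suc K) n = trans
  (cong (ℚ._+ (a ℚ.* u K ℚ.+ b ℚ.* v K) ℚ.* p K n) (weigh-linear a b u v p K n))
  (solve 7 (λ a b U V u v p → a :* U :+ b :* V :+ (a :* u :+ b :* v) :* p :=
                              a :* (U :+ u :* p) :+ b :* (V :+ v :* p)) refl
     a b (weigh u p K n) (weigh v p K n) (u K) (v K) (p K n))

-- A certificate that the prefix sums of u are bounded by those of v: the slack at
-- k is a lower bound of the difference of the sums over the first k entries.
record _≼_ (u v : ℕ → ℚ) : Set where
  field
    slack        : ℕ → ℚ
    slack-nonNeg : ∀ k → NonNegative (slack k)
    slack-zero   : slack 0 ≡ 0ℚ
    slack-suc    : ∀ k → slack (suc k) ℚ.+ u k ℚ.≤ slack k ℚ.+ v k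

record Nonincreasing (p : ℕ → ℕ → ℚ) : Set where
  field
    decreasing : ∀ k → p (suc k) ≲ p k
    nonNeg     : ∀ k → (λ _ → 0ℚ) ≲ p k

weigh-mono : ∀ {u v p} → Nonincreasing p → u ≼ v → ∀ K → weigh u p K ≲ weigh v p K
weigh-mono {u} {v} {p} p↘ u≼v K = begin
  weigh u p K
    ≈⟨ (λ n → solve 2 (λ U s → U := U :+ s :* con 0ℚ) refl (weigh u p K n) (slack K)) ⟩
  (λ n → weigh u p K n ℚ.+ slack K ℚ.* 0ℚ)
    ≲⟨ +-monoʳ-≲ (weigh u p K) (*-monoˡ-≲ (slack K) {{slack-nonNeg K}} (nonNeg K)) ⟩
  (λ n → weigh u p K n ℚ.+ slack K ℚ.* p K n)
    ≲⟨ abel K ⟩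
  weigh v p K ∎
  where
  open _≼_ u≼v
  open Nonincreasing p↘
  abel : ∀ K → (λ n → weigh u p K n ℚ.+ slack K ℚ.* p K n) ≲ weigh v p K
  abel zero = ≲-reflexive λ n → trans
    (cong (λ s → 0ℚ ℚ.+ s ℚ.* p 0 n) slack-zero)
    (solve 1 (λ p → con 0ℚ :+ con 0ℚ :* p := con 0ℚ) refl (p 0 n))
  abel (suc K) = begin
    (λ n → weigh u p K n ℚ.+ u K ℚ.* p K n ℚ.+ slack (suc K) ℚ.* p (suc K) n)
      ≲⟨ +-monoʳ-≲ (weigh u p (suc K)) (*-monoˡ-≲ (slack (suc K)) {{slack-nonNeg (suc K)}} (decreasing K)) ⟩
    (λ n → weigh u p K n ℚ.+ u K ℚ.* p K n ℚ.+ slack (suc K) ℚ.* p K n)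
      ≈⟨ (λ n → solve 4 (λ U u s p → U :+ u :* p :+ s :* p := U :+ (s :+ u) :* p) refl
           (weigh u p K n) (u K) (slack (suc K)) (p K n)) ⟩
    (λ n → weigh u p K n ℚ.+ (slack (suc K) ℚ.+ u K) ℚ.* p K n)
      ≲⟨ +-monoʳ-≲ (weigh u p K) (*-monoʳ-≲ (slack-suc K) (nonNeg K)) ⟩
    (λ n → weigh u p K n ℚ.+ (slack K ℚ.+ v K) ℚ.* p K n)
      ≈⟨ (λ n → solve 4 (λ U s v p → U :+ (s :+ v) :* p := (U :+ s :* p) :+ v :* p) refl
           (weigh u p K n) (slack K) (v K) (p K n)) ⟩
    (λ n → weigh u p K n ℚ.+ slack K ℚ.* p K n ℚ.+ v K ℚ.* p K n)
      ≲⟨ +-monoˡ-≲ (λ n → v K ℚ.* p K n) (abel K) ⟩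
    weigh v p (suc K) ∎

-- Loads as weighted sums

indicator : Bool → ℚ
indicator b = if b then 1ℚ else 0ℚ

indicator-nonNeg : ∀ b → NonNegative (indicator b)
indicator-nonNeg true  = _
indicator-nonNeg false = _

assigned : ∀ {m} → Solution m → Fin m → ℕ → ℚ
assigned S i k = indicator (does (S k Fin.≟ i))

sizes : Realization → ℕ → ℕ → ℚ
sizes p k = seq (size p k)

sizes-nonincreasing : ∀ p → Nonincreasing (sizes p)
sizes-nonincreasing p = record { decreasing = λ k → mk≲ (nonincreasing p k) ; nonNeg = λ k → mk≲ (nonnegative p k) }

load-weigh : ∀ {m} (S : Solution m) p i → seq (load S p i) ≗ weigh (assigned S i) (sizes p) (support p)
load-weigh S p i n = go (support p)
  where
  term : ∀ b x → seq (if b then x else 0ℝ) n ≡ indicator b ℚ.* seq x n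
  term true  x = sym (ℚ.*-identityˡ (seq x n))
  term false x = sym (ℚ.*-zeroˡ (seq x n))
  go : ∀ K → seq (sum K λ k → if does (S k Fin.≟ i) then size p k else 0ℝ) n ≡
             weigh (assigned S i) (sizes p) K n
  go zero    = refl
  go (suc K) = cong₂ ℚ._+_ (go K) (term (does (S K Fin.≟ i)) (size p K))

load≤completionTime : ∀ (S : Solution 2) p i → seq (load S p i) ≲ seq (completionTime S p)
load≤completionTime S p 0F = ≤⇒≲ λ n → ℚ.p≤p⊔q (seq (load S p 0F) n) (seq (load S p 1F) n)
load≤completionTime S p 1F = ≤⇒≲ λ n → ℚ.p≤q⊔p (seq (load S p 0F) n) (seq (load S p 1F) n)

-- Weights bounded by the loads of an arbitrary solution

all first-job twice-third-job : ℕ → ℚ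
all _ = 1ℚ

first-job zero    = 1ℚ
first-job (suc _) = 0ℚ

-- Indices start at zero, so `2` is the third job.
twice-third-job 2 = + 2 / 1
twice-third-job _ = 0ℚ

assigned-all : ∀ (S : Solution 2) k → 1ℚ ℚ.* assigned S 0F k ℚ.+ 1ℚ ℚ.* assigned S 1F k ≡ all k
assigned-all S k with S k
... | 0F = refl
... | 1F = refl

-- On the machine of the first job the comparison holds termwise, so zero slack suffices.
first-job-≼ : ∀ {m} (S : Solution m) → first-job ≼ assigned S (S 0)
first-job-≼ S = record
  { slack = λ _ → 0ℚ
  ; slack-nonNeg = λ _ → _
  ; slack-zero = refl
  ; slack-suc = λ k → ℚ.+-monoʳ-≤ 0ℚ (first≤ k)
  }
  where
  first≤ : ∀ k → first-job k ℚ.≤ assigned S (S 0) k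
  first≤ zero    = ℚ.≤-reflexive (sym (cong indicator (dec-true (S 0 Fin.≟ S 0) refl)))
  first≤ (suc k) = ℚ.nonNegative⁻¹ (assigned S (S 0) (suc k)) {{indicator-nonNeg (does (S (suc k) Fin.≟ S 0))}}

two-of-three-share : ∀ (S : Solution 2) → ∃ λ i →
  + 2 / 1 ℚ.≤ assigned S i 0 ℚ.+ assigned S i 1 ℚ.+ assigned S i 2
two-of-three-share S with S 0 | S 1 | S 2
... | 0F | 0F | 0F = 0F , from-yes (+ 2 / 1 ℚ.≤? + 3 / 1)
... | 0F | 0F | 1F = 0F , ℚ.≤-refl
... | 0F | 1F | 0F = 0F , ℚ.≤-refl
... | 1F | 0F | 0F = 0F , ℚ.≤-refl
... | 0F | 1F | 1F = 1F , ℚ.≤-refl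
... | 1F | 0F | 1F = 1F , ℚ.≤-refl
... | 1F | 1F | 0F = 1F , ℚ.≤-refl
... | 1F | 1F | 1F = 1F , from-yes (+ 2 / 1 ℚ.≤? + 3 / 1)

twice-third-job-≼ : ∀ (S : Solution 2) → ∃ λ i → twice-third-job ≼ assigned S i
twice-third-job-≼ S = i , record
  { slack = slack
  ; slack-nonNeg = slack-nonNeg
  ; slack-zero = refl
  ; slack-suc = slack-suc
  }
  where
  i = proj₁ (two-of-three-share S)
  a : ℕ → ℚ
  a = assigned S i
  a-nonNeg : ∀ k → NonNegative (a k)
  a-nonNeg k = indicator-nonNeg (does (S k Fin.≟ i))
  -- The machine saves what it receives from the first two jobs; with the third this pays the weight
  -- 2, and any remainder is discarded.
  slack : ℕ → ℚ
  slack 1 = a 0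
  slack 2 = a 0 ℚ.+ a 1
  slack _ = 0ℚ
  slack-nonNeg : ∀ k → NonNegative (slack k)
  slack-nonNeg 0 = _
  slack-nonNeg 1 = a-nonNeg 0
  slack-nonNeg 2 = ℚ.nonNeg+nonNeg⇒nonNeg (a 0) {{a-nonNeg 0}} (a 1) {{a-nonNeg 1}}
  slack-nonNeg (suc (suc (suc k))) = _
  slack-suc : ∀ k → slack (suc k) ℚ.+ twice-third-job k ℚ.≤ slack k ℚ.+ a k
  slack-suc 0 = ℚ.≤-reflexive (ℚ.+-comm (a 0) 0ℚ)
  slack-suc 1 = ℚ.≤-reflexive (ℚ.+-identityʳ (a 0 ℚ.+ a 1))
  slack-suc 2 = proj₂ (two-of-three-share S)
  slack-suc (suc (suc (suc k))) = ℚ.+-monoʳ-≤ 0ℚ (ℚ.nonNegative⁻¹ (a (suc (suc (suc k)))) {{a-nonNeg (suc (suc (suc k)))}})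

-- The three prefix comparisons for the algorithm

exact-slack⇒≼ : ∀ {u v} (s : ℕ → ℕ) → s 0 ≡ 0 →
             (∀ k → + s (suc k) / 1 ℚ.+ u k ≡ + s k / 1 ℚ.+ v k) → u ≼ v
exact-slack⇒≼ s s0 step = record
  { slack = λ k → + s k / 1
  ; slack-nonNeg = λ k → ℚ.normalize-nonNeg (s k) 1
  ; slack-zero = cong (λ t → + t / 1) s0
  ; slack-suc = λ k → ℚ.≤-reflexive (step k)
  }

A B : Fin 2 → ℕ → ℚ
A = assigned (first algorithm)
B = assigned (second algorithm)

-- Job 1 is paid by the extra weight 3. Each of the next three jobs earns 1, which the following job
-- of `A 0F` spends; this repeats with period 4. The zero summand fits the two-term shape of
-- `combination-≤`.
A₁-≼ : (λ k → + 4 / 1 ℚ.* A 0F k ℚ.+ 0ℚ ℚ.* all k) ≼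
       (λ k → + 3 / 1 ℚ.* first-job k ℚ.+ 1ℚ ℚ.* all k)
A₁-≼ = exact-slack⇒≼ s refl step
  where
  s : ℕ → ℕ
  s zero    = 0
  s (suc k) = k % 4
  step : ∀ k → + s (suc k) / 1 ℚ.+ (+ 4 / 1 ℚ.* A 0F k ℚ.+ 0ℚ ℚ.* all k) ≡
               + s k / 1 ℚ.+ (+ 3 / 1 ℚ.* first-job k ℚ.+ 1ℚ ℚ.* all k)
  step 0 = refl
  step 1 = refl
  step 2 = refl
  step 3 = refl
  step 4 = refl
  -- A shift by 4 changes nothing after computation, except at index 0, where `first-job` is
  -- nonzero.
  step (suc (suc (suc (suc (suc k))))) = step (suc k)

-- Job 1 earns 2 for job 2, and the extra weight pays for job 3. From then on each even job earns
-- the 2 that the next odd job spends.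
B₂-≼ : (λ k → + 4 / 1 ℚ.* B 1F k ℚ.+ 0ℚ ℚ.* all k) ≼
       (λ k → + 2 / 1 ℚ.* all k ℚ.+ 1ℚ ℚ.* twice-third-job k)
B₂-≼ = exact-slack⇒≼ s refl step
  where
  s : ℕ → ℕ
  s 1 = 2
  s (suc (suc (suc k))) = 2 ℕ.* (k % 2)
  s _ = 0
  step : ∀ k → + s (suc k) / 1 ℚ.+ (+ 4 / 1 ℚ.* B 1F k ℚ.+ 0ℚ ℚ.* all k) ≡
               + s k / 1 ℚ.+ (+ 2 / 1 ℚ.* all k ℚ.+ 1ℚ ℚ.* twice-third-job k)
  step 0 = refl
  step 1 = refl
  step 2 = refl
  step 3 = refl
  step 4 = refl
  step (suc (suc (suc (suc (suc k))))) = step (suc (suc (suc k)))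

-- A job counted in both loads spends 2, one only in `A 1F` earns 1, one only in `B 0F` is neutral,
-- and one in neither earns 3. After job 1 the slack has period 4 and never becomes negative.
A₂B₁-≼ : (λ k → + 2 / 1 ℚ.* A 1F k ℚ.+ + 3 / 1 ℚ.* B 0F k) ≼
         (λ k → + 3 / 1 ℚ.* all k ℚ.+ 0ℚ ℚ.* all k)
A₂B₁-≼ = exact-slack⇒≼ s refl step
  where
  s : ℕ → ℕ
  s 0 = 0
  s 1 = 0
  s 2 = 1
  s 3 = 2
  s 4 = 0
  s 5 = 3
  s (suc (suc (suc (suc (suc (suc k)))))) = s (suc (suc k))
  step : ∀ k → + s (suc k) / 1 ℚ.+ (+ 2 / 1 ℚ.* A 1F k ℚ.+ + 3 / 1 ℚ.* B 0F k) ≡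
               + s k / 1 ℚ.+ (+ 3 / 1 ℚ.* all k ℚ.+ 0ℚ ℚ.* all k)
  step 0 = refl
  step 1 = refl
  step 2 = refl
  step 3 = refl
  step 4 = refl
  step 5 = refl
  step (suc (suc (suc (suc (suc (suc k)))))) = step (suc (suc k))

-- From the comparisons to the competitive ratio

⊓-≤-average : ∀ a b {t} → + 2 / 5 ℚ.* a ℚ.+ + 3 / 5 ℚ.* b ℚ.≤ t → a ℚ.⊓ b ℚ.≤ t
⊓-≤-average a b h = ℚ.≤-trans
  (subst (ℚ._≤ + 2 / 5 ℚ.* a ℚ.+ + 3 / 5 ℚ.* b)
    (solve 1 (λ m → con (+ 2 / 5) :* m :+ con (+ 3 / 5) :* m := m) refl (a ℚ.⊓ b))
    (ℚ.+-mono-≤ (ℚ.*-monoˡ-≤-nonNeg (+ 2 / 5) (ℚ.p⊓q≤p a b))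
                (ℚ.*-monoˡ-≤-nonNeg (+ 3 / 5) (ℚ.p⊓q≤q a b))))
  h

-- The smaller of `a₂` and `b₁` is at most their average, and it decides which of the two solutions
-- is good.
⊔⊓⊔-≤ : ∀ a₁ a₂ b₁ b₂ {t} → a₁ ℚ.≤ t → b₂ ℚ.≤ t → + 2 / 5 ℚ.* a₂ ℚ.+ + 3 / 5 ℚ.* b₁ ℚ.≤ t →
        (a₁ ℚ.⊔ a₂) ℚ.⊓ (b₁ ℚ.⊔ b₂) ℚ.≤ t
⊔⊓⊔-≤ a₁ a₂ b₁ b₂ a₁≤t b₂≤t h with ℚ.⊓-sel a₂ b₁
... | inj₁ e = ℚ.≤-trans (ℚ.p⊓q≤p _ _)
  (ℚ.⊔-lub a₁≤t (subst (ℚ._≤ _) e (⊓-≤-average a₂ b₁ h)))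
... | inj₂ e = ℚ.≤-trans (ℚ.p⊓q≤q (a₁ ℚ.⊔ a₂) _)
  (ℚ.⊔-lub (subst (ℚ._≤ _) e (⊓-≤-average a₂ b₁ h)) b₂≤t)

module _ (p : Realization) (S : Solution 2) where

  private
    C : ℕ → ℚ
    C = seq (completionTime S p)

    ⟦_⟧ : (ℕ → ℚ) → ℕ → ℚ
    ⟦ w ⟧ = weigh w (sizes p) (support p)

    assigned≤C : ∀ i → ⟦ assigned S i ⟧ ≲ C
    assigned≤C i = begin
      ⟦ assigned S i ⟧   ≈⟨ (λ n → sym (load-weigh S p i n)) ⟩
      seq (load S p i)   ≲⟨ load≤completionTime S p i ⟩
      C                  ∎

    ≼⇒≤C : ∀ {w i} → w ≼ assigned S i → ⟦ w ⟧ ≲ C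
    ≼⇒≤C {w} {i} h = begin
      ⟦ w ⟧              ≲⟨ weigh-mono (sizes-nonincreasing p) h (support p) ⟩
      ⟦ assigned S i ⟧   ≲⟨ assigned≤C i ⟩
      C                  ∎

    all≤2C : ⟦ all ⟧ ≲ (λ n → + 2 / 1 ℚ.* C n)
    all≤2C = begin
      ⟦ all ⟧
        ≈⟨ (λ n → trans (sym (weigh-cong (assigned-all S) (sizes p) (support p) n))
             (weigh-linear 1ℚ 1ℚ (assigned S 0F) (assigned S 1F) (sizes p) (support p) n)) ⟩
      (λ n → 1ℚ ℚ.* ⟦ assigned S 0F ⟧ n ℚ.+ 1ℚ ℚ.* ⟦ assigned S 1F ⟧ n)
        ≲⟨ +-mono-≲ (*-monoˡ-≲ 1ℚ (assigned≤C 0F)) (*-monoˡ-≲ 1ℚ (assigned≤C 1F)) ⟩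
      (λ n → 1ℚ ℚ.* C n ℚ.+ 1ℚ ℚ.* C n)
        ≈⟨ (λ n → solve 1 (λ c → con 1ℚ :* c :+ con 1ℚ :* c := con (+ 2 / 1) :* c) refl (C n)) ⟩
      (λ n → + 2 / 1 ℚ.* C n) ∎

  combination-≤ : ∀ a b a′ b′ {u v u′ v′ r s} → .{{NonNegative a′}} → .{{NonNegative b′}} →
    (λ k → a ℚ.* u k ℚ.+ b ℚ.* v k) ≼ (λ k → a′ ℚ.* u′ k ℚ.+ b′ ℚ.* v′ k) →
    ⟦ u′ ⟧ ≲ (λ n → r ℚ.* C n) → ⟦ v′ ⟧ ≲ (λ n → s ℚ.* C n) →
    (λ n → a ℚ.* ⟦ u ⟧ n ℚ.+ b ℚ.* ⟦ v ⟧ n) ≲ (λ n → (a′ ℚ.* r ℚ.+ b′ ℚ.* s) ℚ.* C n)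
  combination-≤ a b a′ b′ {u} {v} {u′} {v′} {r} {s} h u′≤ v′≤ = begin
    (λ n → a ℚ.* ⟦ u ⟧ n ℚ.+ b ℚ.* ⟦ v ⟧ n)
      ≈⟨ (λ n → sym (weigh-linear a b u v (sizes p) (support p) n)) ⟩
    ⟦ (λ k → a ℚ.* u k ℚ.+ b ℚ.* v k) ⟧
      ≲⟨ weigh-mono (sizes-nonincreasing p) h (support p) ⟩
    ⟦ (λ k → a′ ℚ.* u′ k ℚ.+ b′ ℚ.* v′ k) ⟧
      ≈⟨ weigh-linear a′ b′ u′ v′ (sizes p) (support p) ⟩
    (λ n → a′ ℚ.* ⟦ u′ ⟧ n ℚ.+ b′ ℚ.* ⟦ v′ ⟧ n)
      ≲⟨ +-mono-≲ (*-monoˡ-≲ a′ u′≤) (*-monoˡ-≲ b′ v′≤) ⟩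
    (λ n → a′ ℚ.* (r ℚ.* C n) ℚ.+ b′ ℚ.* (s ℚ.* C n))
      ≈⟨ (λ n → solve 5 (λ a b r s c → a :* (r :* c) :+ b :* (s :* c) := (a :* r :+ b :* s) :* c)
           refl a′ b′ r s (C n)) ⟩
    (λ n → (a′ ℚ.* r ℚ.+ b′ ℚ.* s) ℚ.* C n) ∎

  algorithm-competitive : ∀ opt → 0ℝ < opt →
    completionTime S p ≈ opt → seq (makespan algorithm p) ≲ λ n → + 5 / 4 ℚ.* seq opt n
  algorithm-competitive opt (δ , δ>0 , δ≤opt) C≈opt = record { bound = λ ε →
    -- Maxima and minima of reals are taken termwise, so the choice between the solutions may vary
    -- with `n`.
    zipEventually (λ {n} a₁≤ (b₂≤ , a₂b₁≤) → ⊔⊓⊔-≤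
        (a 0F n) (a 1F n) (b 0F n) (b 1F n) a₁≤ b₂≤ a₂b₁≤)
      (bound A₁≤ ε) (zipEventually _,_ (bound B₂≤ ε) (bound A₂B₁≤ ε)) }
    where
    a b : Fin 2 → ℕ → ℚ
    a i = seq (load (first algorithm) p i)
    b i = seq (load (second algorithm) p i)

    C≤opt : C ≲ seq opt
    C≤opt .bound ε = mapEventually (λ {n} → ∣-∣≤⇒≤+ (C n) (seq opt n)) (C≈opt ε)

    0≤opt : (λ _ → 0ℚ) ≲ seq opt
    0≤opt .bound ε = mapEventually (λ {n} h → ℚ.≤-trans (p≤p+ε 0ℚ δ {{δ>0}})
      (ℚ.≤-trans h (p≤p+ε (seq opt n) ε))) δ≤opt

    scaled : ∀ r c → .{{NonNegative c}} → .{{NonNegative r}} → ∀ {x y} → x ≲ (λ n → c ℚ.* C n) →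
             y ≗ (λ n → r ℚ.* x n) → r ℚ.* c ℚ.≤ + 5 / 4 → y ≲ (λ n → + 5 / 4 ℚ.* seq opt n)
    scaled r c {x} {y} x≤ y≗ rc≤ = begin
      y                                ≈⟨ y≗ ⟩
      (λ n → r ℚ.* x n)                ≲⟨ *-monoˡ-≲ r x≤ ⟩
      (λ n → r ℚ.* (c ℚ.* C n))        ≲⟨ *-monoˡ-≲ r (*-monoˡ-≲ c C≤opt) ⟩
      (λ n → r ℚ.* (c ℚ.* seq opt n))  ≈⟨ (λ n → sym (ℚ.*-assoc r c (seq opt n))) ⟩
      -- Raising the factor, as from 6/5 in `A₂B₁≤`, relies on the optimum being nonnegative.
      (λ n → (r ℚ.* c) ℚ.* seq opt n)  ≲⟨ *-monoʳ-≲ rc≤ 0≤opt ⟩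
      (λ n → + 5 / 4 ℚ.* seq opt n)    ∎

    unit : ∀ {x} → x ≲ C → x ≲ (λ n → 1ℚ ℚ.* C n)
    unit {x} h = begin
      x                   ≲⟨ h ⟩
      C                   ≈⟨ (λ n → sym (ℚ.*-identityˡ (C n))) ⟩
      (λ n → 1ℚ ℚ.* C n)  ∎

    A₁≤ : a 0F ≲ (λ n → + 5 / 4 ℚ.* seq opt n)
    A₁≤ = scaled (+ 1 / 4) (+ 5 / 1)
      (combination-≤ (+ 4 / 1) 0ℚ (+ 3 / 1) 1ℚ {u = A 0F} {v = all} {r = 1ℚ} {s = + 2 / 1} A₁-≼
        (unit (≼⇒≤C (first-job-≼ S))) all≤2C)
      (λ n → trans (load-weigh (first algorithm) p 0F n)
        (solve 2 (λ x y → x := con (+ 1 / 4) :* (con (+ 4 / 1) :* x :+ con 0ℚ :* y)) refl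
          (⟦ A 0F ⟧ n) (⟦ all ⟧ n)))
      ℚ.≤-refl

    B₂≤ : b 1F ≲ (λ n → + 5 / 4 ℚ.* seq opt n)
    B₂≤ = scaled (+ 1 / 4) (+ 5 / 1)
      (combination-≤ (+ 4 / 1) 0ℚ (+ 2 / 1) 1ℚ {u = B 1F} {v = all} {r = + 2 / 1} {s = 1ℚ} B₂-≼
        all≤2C (unit (≼⇒≤C (proj₂ (twice-third-job-≼ S)))))
      (λ n → trans (load-weigh (second algorithm) p 1F n)
        (solve 2 (λ x y → x := con (+ 1 / 4) :* (con (+ 4 / 1) :* x :+ con 0ℚ :* y)) refl
          (⟦ B 1F ⟧ n) (⟦ all ⟧ n)))
      ℚ.≤-refl

    A₂B₁≤ : (λ n → + 2 / 5 ℚ.* a 1F n ℚ.+ + 3 / 5 ℚ.* b 0F n) ≲ (λ n → + 5 / 4 ℚ.* seq opt n)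
    -- The 6 is three times the bound 2 on the total size; the factor 1/5 makes the weights 2 and 3
    -- a convex combination.
    A₂B₁≤ = scaled (+ 1 / 5) (+ 6 / 1)
      (combination-≤ (+ 2 / 1) (+ 3 / 1) (+ 3 / 1) 0ℚ {u = A 1F} {v = B 0F}
        {r = + 2 / 1} {s = + 2 / 1} A₂B₁-≼ all≤2C all≤2C)
      (λ n → trans
        (cong₂ (λ x y → + 2 / 5 ℚ.* x ℚ.+ + 3 / 5 ℚ.* y)
          (load-weigh (first algorithm) p 1F n) (load-weigh (second algorithm) p 0F n))
        (solve 2 (λ x y → con (+ 2 / 5) :* x :+ con (+ 3 / 5) :* y :=
                          con (+ 1 / 5) :* (con (+ 2 / 1) :* x :+ con (+ 3 / 1) :* y)) refl
          (⟦ A 1F ⟧ n) (⟦ B 0F ⟧ n)))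
      (from-yes (+ 6 / 5 ℚ.≤? + 5 / 4))

theorem3 : CompetitiveRatioAtMost algorithm (fromℚ (+ 5 / 4))
theorem3 p opt (_ , ¬¬attained) opt>0 =
  -- Stability of the goal gives access to a solution attaining the optimum, whose existence is
  -- known only doubly negated.
  ≤-stable (divide (makespan algorithm p) opt opt>0) (fromℚ (+ 5 / 4)) λ ¬h →
    ¬¬attained λ (S , C≈opt) → ¬h (divide-≤ (makespan algorithm p) opt opt>0 (+ 5 / 4)
      (algorithm-competitive p S opt opt>0 C≈opt))
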